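{- Let $A=(1,a_1,\ldots,a_k)$ be an orderly currency and let $2\leq m\leq k$ be such that $a_{m-1}>2a_{m-2}$ and $a_m>2a_{m-1}$. Then for every $t$ with $m\leq t\leq k-1$ we have $a_{t+1}-a_t\geq a_m-a_{m-1}$.
   Context: A currency is a finite sequence of integers $A=(a_0,a_1,\ldots,a_k)$ with $1=a_0<a_1<\cdots<a_k$. For an integer amount $c>0$, $\mathrm{opt}_A(c)$ is the minimum number of coins (values from $A$, repetitions allowed) summing to $c$, and $\mathrm{grd}_A(c)$ is the number of coins used by the greedy algorithm, which repeatedly takes the largest coin not exceeding the remaining amount. $A$ is orderly if $\mathrm{opt}_A(c)=\mathrm{grd}_A(c)$ for all integers $c>0$. -}

module Defs where

open import Data.Nat using (ℕ; zero; suc; _+_; _∸_; _≤_; _<_; _≤?_; _<?_)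
open import Data.Fin using (Fin; toℕ; fromℕ; fromℕ<; inject₁)
open import Data.List using (List; []; _∷_; length; map)
open import Data.Nat.ListAction using (sum)
open import Data.Product using (Σ; _×_; _,_)
open import Relation.Binary.PropositionalEquality using (_≡_)
open import Relation.Nullary using (yes; no)

record Currency (k : ℕ) : Set where
  field
    coin     : Fin (suc k) → ℕ
    coin-0   : coin Data.Fin.zero ≡ 1
    coin-inc : (i : Fin k) → coin (inject₁ i) < coin (Data.Fin.suc i)
open Currency public

coinSum : ∀ {k} → Currency k → List (Fin (suc k)) → ℕ
coinSum A xs = sum (map (coin A) xs)

IsOpt : ∀ {k} → Currency k → ℕ → ℕ → Set
IsOpt {k} A c n =
  Σ (List (Fin (suc k))) (λ xs → (coinSum A xs ≡ c) × (length xs ≡ n))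
  × ((ys : List (Fin (suc k))) → coinSum A ys ≡ c → n ≤ length ys)


-- a_i as a function of a natural index i; only meaningful for i ≤ k
-- (returns 0 out of range; the statement only uses indices ≤ k).

a_ : ∀ {k} → Currency k → ℕ → ℕ
a_ {k} A i with i <? suc k
... | yes p = coin A (fromℕ< p)
... | no  _ = 0

largestCoin : ∀ {k} → Currency k → ℕ → ℕ → ℕ
largestCoin A c zero = a_ A 0
largestCoin A c (suc j) with a_ A (suc j) ≤? c
... | yes _ = a_ A (suc j)
... | no  _ = largestCoin A c j

-- Greedy algorithm: number of coins used, with fuel (each step removes
-- at least one unit since a_0 = 1, so fuel c suffices for amount c).
grdFuel : ∀ {k} → Currency k → ℕ → ℕ → ℕ
grdFuel A zero    c       = 0
grdFuel A (suc f) zero    = 0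
grdFuel {k} A (suc f) (suc c) =
  suc (grdFuel A f (suc c ∸ largestCoin A (suc c) k))

grd : ∀ {k} → Currency k → ℕ → ℕ
grd A c = grdFuel A c c

Orderly : ∀ {k} → Currency k → Set
Orderly A = (c : ℕ) → 0 < c → IsOpt A c (grd A c)

{-# OPTIONS --safe #-}
-- If a_n is the largest coin not exceeding a_i + a_j, then orderliness forces
-- a_i + a_j - a_n to be zero or a coin.  Let D = a_m - a_(m-1), and suppose that some gap
-- from a_m on is shorter than D; let a_s be the lower end of the first one and put
-- G = a_(s+1) - a_(m-1) > D.  Descending from the top coin, every gap g = a_(T+1) - a_T
-- with T ≥ s is at least G, which at T = s is absurd.  Indeed, let g < G while all later
-- gaps are at least G.
--   * If a_T + a_(s+1) < a_(T+2), then a_s - g and a_(s+1) - g are coins (or zero) closer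
--     than D, the larger one lies above a_(m-1), and both lie below the first short gap.
--   * Otherwise g ≤ a_(m-1), so a_m - g is not a coin and a_(T+2) ≤ a_T + a_m.  Since
--     a_(m-1) - g is a coin or zero, g ≥ a_(m-1) - a_(m-2) > a_(m-2).  But then
--     a_(T+1) + a_m - a_(T+2) is a coin in [g, a_(m-1)), which is impossible.
module Submission where

open import Defs
open import Data.Nat using (ℕ; zero; suc; _+_; _*_; _∸_; _≤_; _<_; _≤?_; _<?_; z≤n; s≤s; s≤s⁻¹)
open import Data.Nat.Properties
open import Data.Nat.Induction using (<-rec)
open import Data.Fin using (Fin; toℕ; fromℕ<; inject₁)
open import Data.Fin.Properties using (toℕ-fromℕ<; fromℕ<-toℕ; toℕ-inject₁; toℕ<n)
open import Data.List using ([]; _∷_)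
open import Data.Product using (∃-syntax; _×_; _,_)
open import Data.Sum using (_⊎_; inj₁; inj₂)
open import Data.Empty using (⊥)
open import Function using (case_of_)
open import Relation.Nullary using (yes; no; contradiction)
open import Relation.Binary.PropositionalEquality

-- Coin values under natural-number indices.

value-fromℕ< : ∀ {k} (A : Currency k) {i} (i<1+k : i < suc k) → a_ A i ≡ coin A (fromℕ< i<1+k)
value-fromℕ< {k} A {i} i<1+k with i <? suc k
... | yes p = cong (λ q → coin A (fromℕ< q)) (<-irrelevant p i<1+k)
... | no ¬p = contradiction i<1+k ¬p

value-toℕ : ∀ {k} (A : Currency k) (x : Fin (suc k)) → a_ A (toℕ x) ≡ coin A x
value-toℕ A x = trans (value-fromℕ< A (toℕ<n x)) (cong (coin A) (fromℕ<-toℕ x (toℕ<n x)))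

value-step : ∀ {k} (A : Currency k) {i} → i < k → a_ A i < a_ A (suc i)
value-step A {i} i<k = subst₂ _<_ lower upper (coin-inc A x)
  where
  x = fromℕ< i<k
  lower : coin A (inject₁ x) ≡ a_ A i
  lower = trans (sym (value-toℕ A (inject₁ x)))
                (cong (a_ A) (trans (toℕ-inject₁ x) (toℕ-fromℕ< i<k)))
  upper : coin A (Fin.suc x) ≡ a_ A (suc i)
  upper = trans (sym (value-toℕ A (Fin.suc x))) (cong (λ j → a_ A (suc j)) (toℕ-fromℕ< i<k))

-- The first greedy coin and short greedy runs.

largestCoin-is-coin : ∀ {k} (A : Currency k) c j → ∃[ i ] i ≤ j × largestCoin A c j ≡ a_ A i
largestCoin-is-coin A c zero = 0 , z≤n , refl
largestCoin-is-coin A c (suc j) with a_ A (suc j) ≤? c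
... | yes _ = suc j , ≤-refl , refl
... | no  _ with largestCoin-is-coin A c j
...   | i , i≤j , eq = i , m≤n⇒m≤1+n i≤j , eq

largestCoin-≤ : ∀ {k} (A : Currency k) {c} j → 0 < c → largestCoin A c j ≤ c
largestCoin-≤ A zero 0<c = subst (_≤ _) (sym (trans (value-toℕ A Fin.zero) (coin-0 A))) 0<c
largestCoin-≤ A {c} (suc j) 0<c with a_ A (suc j) ≤? c
... | yes p = p
... | no  _ = largestCoin-≤ A j 0<c

largestCoin-unique : ∀ {k} (A : Currency k) {c n} j → n ≤ j → a_ A n ≤ c →
  (∀ {i} → n < i → i ≤ j → c < a_ A i) → largestCoin A c j ≡ a_ A n
largestCoin-unique A zero z≤n _ _ = refl
largestCoin-unique A {c} {n} (suc j) n≤1+j an≤c above with a_ A (suc j) ≤? c | m≤n⇒m<n∨m≡n n≤1+j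
... | yes _ | inj₂ refl = refl
... | yes p | inj₁ n<1+j = contradiction p (<⇒≱ (above n<1+j ≤-refl))
... | no ¬p | inj₂ refl = contradiction an≤c ¬p
... | no _  | inj₁ n<1+j =
  largestCoin-unique A j (s≤s⁻¹ n<1+j) an≤c (λ n<i i≤j → above n<i (m≤n⇒m≤1+n i≤j))

-- The bound `c ≤ f` rules out a run that stops for lack of fuel, which would also report no coins.
grdFuel≡0⇒≡0 : ∀ {k} (A : Currency k) {f c} → c ≤ f → grdFuel A f c ≡ 0 → c ≡ 0
grdFuel≡0⇒≡0 A {zero}  {zero}  _ _ = refl
grdFuel≡0⇒≡0 A {suc f} {zero}  _ _ = refl
grdFuel≡0⇒≡0 A {suc f} {suc c} _ ()

value-positive : ∀ {k} (A : Currency k) {i} → i ≤ k → 0 < a_ A i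
value-positive A {zero}  _   = subst (0 <_) (sym (trans (value-toℕ A Fin.zero) (coin-0 A))) (s≤s z≤n)
value-positive A {suc i} i<k = ≤-<-trans z≤n (value-step A i<k)

CoinOrZero : ∀ {k} → Currency k → ℕ → Set
CoinOrZero {k} A r = r ≡ 0 ⊎ (∃[ i ] i ≤ k × r ≡ a_ A i)

grdFuel≤1⇒coinOrZero : ∀ {k} (A : Currency k) {f r} → r ≤ f → grdFuel A f r ≤ 1 → CoinOrZero A r
grdFuel≤1⇒coinOrZero A {r = zero} _ _ = inj₁ refl
grdFuel≤1⇒coinOrZero {k} A {suc f} {suc r} (s≤s r≤f) (s≤s grd≤0)
  with largestCoin-is-coin A (suc r) k
... | i , i≤k , eq = inj₂ (i , i≤k , trans (≤-antisym rest≡0 (largestCoin-≤ A k (s≤s z≤n))) eq)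
  where
  L = largestCoin A (suc r) k
  L>0 : 0 < L
  L>0 = subst (0 <_) (sym eq) (value-positive A i≤k)
  rest≤f : suc r ∸ L ≤ f
  rest≤f = ≤-trans (∸-monoʳ-≤ (suc r) L>0) r≤f
  rest≡0 : suc r ≤ L
  rest≡0 = m∸n≡0⇒m≤n (grdFuel≡0⇒≡0 A rest≤f (n≤0⇒n≡0 grd≤0))

-- Order of the coins and sums of two coins.

module _ {k} (A : Currency k) where
  private
    v : ℕ → ℕ
    v = a_ A

  value-mono-≤ : ∀ {i} j → i ≤ j → j ≤ k → v i ≤ v j
  value-mono-≤ zero z≤n _ = ≤-refl
  value-mono-≤ (suc j) i≤1+j j<k with m≤n⇒m<n∨m≡n i≤1+j
  ... | inj₂ refl = ≤-refl
  ... | inj₁ i<1+j = ≤-trans (value-mono-≤ j (s≤s⁻¹ i<1+j) (<⇒≤ j<k)) (<⇒≤ (value-step A j<k))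

  value-cancel-< : ∀ {i j} → i ≤ k → v i < v j → i < j
  value-cancel-< {i} {j} i≤k vi<vj = ≰⇒> λ j≤i → <⇒≱ vi<vj (value-mono-≤ i j≤i i≤k)

  no-coin-between : ∀ {r} j → j < k → CoinOrZero A r → v j < r → r < v (suc j) → ⊥
  no-coin-between j j<k (inj₁ refl) ()
  no-coin-between j j<k (inj₂ (i , i≤k , refl)) vj<vi vi<v1+j =
    <⇒≱ (value-cancel-< (<⇒≤ j<k) vj<vi) (s≤s⁻¹ (value-cancel-< i≤k vi<v1+j))

  -- The guard matters at the top index, where no next coin exists and `a_` returns 0.
  Below : ℕ → ℕ → Set
  Below c n = suc n ≤ k → c < v (suc n)

  module _ (orderly : Orderly A) where

    -- Two coins pay the amount, so by orderliness greedy uses at most two. `Below` makes `v n` its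
    -- first coin, which leaves at most one coin for `r`.
    two-coins : ∀ {i j r} n → i ≤ k → j ≤ k → n ≤ k → v i + v j ≡ v n + r →
      Below (v i + v j) n → CoinOrZero A r
    two-coins {i} {j} {r} n i≤k j≤k n≤k eq below = go (v i + v j) refl
      where
      xs = fromℕ< (s≤s i≤k) ∷ fromℕ< (s≤s j≤k) ∷ []
      xs-sum : coinSum A xs ≡ v i + v j
      xs-sum = cong₂ _+_ (sym (value-fromℕ< A (s≤s i≤k)))
                         (trans (+-identityʳ _) (sym (value-fromℕ< A (s≤s j≤k))))
      an>0 : 0 < v n
      an>0 = value-positive A n≤k
      -- The amount is abstracted to `c` so that it can be split: `grd` unfolds only at a successor.
      go : ∀ c → c ≡ v i + v j → CoinOrZero A r
      go zero c≡ = contradiction (m+n≡0⇒m≡0 (v n) (sym (trans c≡ eq))) (>⇒≢ an>0)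
      go (suc c) c≡ with orderly (suc c) (s≤s z≤n)
      ... | _ , minimal = grdFuel≤1⇒coinOrZero A r≤c (subst (λ x → grdFuel A c x ≤ 1) rest grd≤1)
        where
        c≡an+r : suc c ≡ v n + r
        c≡an+r = trans c≡ eq
        largest : largestCoin A (suc c) k ≡ v n
        largest = largestCoin-unique A k n≤k (subst (v n ≤_) (sym c≡an+r) (m≤m+n _ r))
          λ {l} n<l l≤k → subst (_< v l) (sym c≡)
            (<-≤-trans (below (≤-trans n<l l≤k)) (value-mono-≤ l n<l l≤k))
        rest : suc c ∸ largestCoin A (suc c) k ≡ r
        rest = trans (cong₂ _∸_ c≡an+r largest) (m+n∸m≡n (v n) r)
        grd≤1 : grdFuel A c (suc c ∸ largestCoin A (suc c) k) ≤ 1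
        grd≤1 = s≤s⁻¹ (minimal xs (trans xs-sum (sym c≡)))
        r≤c : r ≤ c
        r≤c = s≤s⁻¹ (subst (suc r ≤_) (sym c≡an+r) (+-monoˡ-≤ r an>0))

    -- Here q = m - 2 and p = m - 1.
    module _ {q D} (p<k : suc q < k) (D+b≡ : D + v (suc q) ≡ v (suc (suc q)))
             (2c<b : v q + v q < v (suc q)) (b<D : v (suc q) < D) where
      private
        p = suc q
        b = v p

        q<k : q < k
        q<k = <⇒≤ p<k

      -- Contradiction from a first short gap.

      module _ {s G} (p<s : p < s) (s<k : s < k) (short : v (suc s) < v s + D)
               (before : ∀ {j} → p ≤ j → j < s → v j + D ≤ v (suc j))
               (G+b≡ : G + b ≡ v (suc s)) where

        D<G : D < G
        D<G = +-cancelʳ-< b D G (begin-strict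
          D + b     ≡⟨ D+b≡ ⟩
          v (suc p) ≤⟨ value-mono-≤ s p<s (<⇒≤ s<k) ⟩
          v s       <⟨ value-step A s<k ⟩
          v (suc s) ≡⟨ G+b≡ ⟨
          G + b     ∎)
          where open ≤-Reasoning

        module _ {T} (T<k : T < k)
                 (after : ∀ {j} → T < j → j < k → v j + G ≤ v (suc j))
                 (g : ℕ) (g≡ : v (suc T) ≡ v T + g) (g<G : g < G) where

          0<g : 0 < g
          0<g = +-cancelˡ-< (v T) 0 g
            (subst₂ _<_ (sym (+-identityʳ (v T))) g≡ (value-step A T<k))

          -- Puts `v T + x` in the shape that `two-coins` expects, with first greedy coin
          -- `v (suc T)` and remainder `x - g`.
          shift : ∀ {x r} → x ≡ g + r → v T + x ≡ v (suc T) + r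
          shift {r = r} refl = trans (sym (+-assoc (v T) g r)) (cong (_+ r) (sym g≡))

          no-short-gap-isolated : Below (v T + v (suc s)) (suc T) → ⊥
          no-short-gap-isolated below with m≤n⇒∃[o]m+o≡n (<⇒≤ g<G)
          ... | h , refl = go r′-coin
            where
            open ≤-Reasoning
            r′ = h + b
            r′≡ : v (suc s) ≡ g + r′
            r′≡ = trans (sym G+b≡) (+-assoc g h b)
            r′-coin : CoinOrZero A r′
            r′-coin = two-coins (suc T) (<⇒≤ T<k) s<k T<k (shift r′≡) below
            0<h : 0 < h
            0<h = +-cancelˡ-< g 0 h (subst (_< g + h) (sym (+-identityʳ g)) g<G)
            b<r′ : b < r′
            b<r′ = +-monoˡ-≤ b 0<h
            -- As a coin above `b`, `r′` is at least the next coin `D + b`.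
            D≤r′ : D ≤ r′
            D≤r′ = ≤-trans (subst (D ≤_) D+b≡ (m≤m+n D b))
                           (≮⇒≥ (no-coin-between p p<k r′-coin b<r′))
            -- Ensures that the truncated difference `r` below is the true one.
            g≤vs : g ≤ v s
            g≤vs = +-cancelʳ-≤ D g (v s) (begin
              g + D     ≤⟨ +-monoʳ-≤ g D≤r′ ⟩
              g + r′    ≡⟨ r′≡ ⟨
              v (suc s) ≤⟨ <⇒≤ short ⟩
              v s + D   ∎)
            r = v s ∸ g
            r≡ : v s ≡ g + r
            r≡ = sym (m+[n∸m]≡n g≤vs)
            r-coin : CoinOrZero A r
            r-coin = two-coins (suc T) (<⇒≤ T<k) (<⇒≤ s<k) T<k (shift r≡)
              λ 1+T<k → ≤-<-trans (+-monoʳ-≤ (v T) (<⇒≤ (value-step A s<k))) (below 1+T<k)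
            r<r′ : r < r′
            r<r′ = +-cancelˡ-< g r r′ (subst₂ _<_ r≡ r′≡ (value-step A s<k))
            r′<r+D : r′ < r + D
            r′<r+D = +-cancelˡ-< g r′ (r + D)
              (subst₂ _<_ r′≡ (trans (cong (_+ D) r≡) (+-assoc g r D)) short)
            r′<v1+s : r′ < v (suc s)
            r′<v1+s = subst (r′ <_) (sym r′≡) (+-monoˡ-≤ r′ 0<g)
            go : CoinOrZero A r′ → ⊥
            go (inj₁ r′≡0) = >⇒≢ (≤-<-trans z≤n b<r′) r′≡0
            go (inj₂ (zero , _ , r′≡v0)) =
              contradiction (value-cancel-< {j = 0} (<⇒≤ p<k) (subst (b <_) r′≡v0 b<r′)) λ ()
            -- The gap from `v j` up to `r′` precedes the first short one, so it is at least `D`;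
            -- but `r` is less than `D` below `r′`, hence strictly inside that gap.
            go (inj₂ (suc j , j<k , r′≡vj)) = no-coin-between j j<k r-coin vj<r (subst (r <_) r′≡vj r<r′)
              where
              p≤j : p ≤ j
              p≤j = s≤s⁻¹ (value-cancel-< (<⇒≤ p<k) (subst (b <_) r′≡vj b<r′))
              j<s : j < s
              j<s = s≤s⁻¹ (value-cancel-< j<k (subst (_< v (suc s)) r′≡vj r′<v1+s))
              vj<r : v j < r
              vj<r = +-cancelʳ-< D (v j) r (begin-strict
                v j + D   ≤⟨ before p≤j j<s ⟩
                v (suc j) ≡⟨ r′≡vj ⟨
                r′        <⟨ r′<r+D ⟩
                r + D     ∎)

          no-short-gap-crowded : suc T < k → v (suc (suc T)) ≤ v T + v (suc s) → ⊥
          no-short-gap-crowded 1+T<k close = no-coin-between q q<k w-coin (<-≤-trans c<g g≤w) w<b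
            where
            open ≤-Reasoning
            e = v (suc (suc T)) ∸ v (suc T)
            e≡ : v (suc (suc T)) ≡ v (suc T) + e
            e≡ = sym (m+[n∸m]≡n (<⇒≤ (value-step A 1+T<k)))
            G≤e : G ≤ e
            G≤e = +-cancelˡ-≤ (v (suc T)) G e (subst (v (suc T) + G ≤_) e≡ (after ≤-refl 1+T<k))
            D<e : D < e
            D<e = <-≤-trans D<G G≤e
            -- The sum `g + e` spans two consecutive gaps, starting at `v T`.
            g+e≡ : v (suc (suc T)) ≡ v T + (g + e)
            g+e≡ = trans e≡ (trans (cong (_+ e) g≡) (+-assoc (v T) g e))
            g+e≤ : ∀ {x} → v (suc (suc T)) ≤ v T + x → g + e ≤ x
            g+e≤ {x} h = +-cancelˡ-≤ (v T) (g + e) x (subst (_≤ v T + x) g+e≡ h)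
            g≤b : g ≤ b
            g≤b = +-cancelˡ-≤ G g b (begin
              G + g     ≤⟨ +-monoˡ-≤ g G≤e ⟩
              e + g     ≡⟨ +-comm e g ⟩
              g + e     ≤⟨ g+e≤ close ⟩
              v (suc s) ≡⟨ G+b≡ ⟨
              G + b     ∎)

            vm = v (suc p)
            g<D : g < D
            g<D = ≤-<-trans g≤b b<D
            u≡ : vm ≡ g + (D ∸ g + b)
            u≡ = begin-equality
              vm              ≡⟨ D+b≡ ⟨
              D + b           ≡⟨ cong (_+ b) (m+[n∸m]≡n (<⇒≤ g<D)) ⟨
              g + (D ∸ g) + b ≡⟨ +-assoc g (D ∸ g) b ⟩
              g + (D ∸ g + b) ∎
            -- The remainder `vm - g` lies strictly between `b` and `vm`, so `v (suc T)` cannot be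
            -- the first greedy coin for `v T + vm`.
            g+e≤vm : g + e ≤ vm
            g+e≤vm = g+e≤ (≮⇒≥ λ far → no-coin-between p p<k
              (two-coins (suc T) (<⇒≤ T<k) p<k T<k (shift u≡) (λ _ → far))
              (+-monoˡ-≤ b (m<n⇒0<n∸m g<D))
              (subst (D ∸ g + b <_) (sym u≡) (+-monoˡ-≤ _ 0<g)))

            r = b ∸ g
            r≡ : b ≡ g + r
            r≡ = sym (m+[n∸m]≡n g≤b)
            -- Here `b < D < e` keeps `v T + b` below `v (suc (suc T))`.
            r-coin : CoinOrZero A r
            r-coin = two-coins (suc T) (<⇒≤ T<k) (<⇒≤ p<k) T<k (shift r≡) λ _ →
              subst (v T + b <_) (sym g+e≡)
                (+-monoʳ-< (v T) (<-≤-trans (<-trans b<D D<e) (m≤n+m e g)))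
            r≤c : r ≤ v q
            r≤c = ≮⇒≥ λ c<r → no-coin-between q q<k r-coin c<r
              (subst (r <_) (sym r≡) (+-monoˡ-≤ r 0<g))
            c<g : v q < g
            c<g = +-cancelʳ-< (v q) (v q) g (begin-strict
              v q + v q <⟨ 2c<b ⟩
              b         ≡⟨ r≡ ⟩
              g + r     ≤⟨ +-monoʳ-≤ g r≤c ⟩
              g + v q   ∎)

            -- Since `D < e` and `g + e ≤ vm`, this lands in `[g, b)`, where `v q < g` leaves no
            -- coin.
            w = vm ∸ e
            w≡ : vm ≡ e + w
            w≡ = sym (m+[n∸m]≡n (≤-trans (m≤n+m e g) g+e≤vm))
            g≤w : g ≤ w
            g≤w = +-cancelˡ-≤ e g w (begin
              e + g ≡⟨ +-comm e g ⟩
              g + e ≤⟨ g+e≤vm ⟩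
              vm    ≡⟨ w≡ ⟩
              e + w ∎)
            w<b : w < b
            w<b = +-cancelˡ-< D w b (begin-strict
              D + w <⟨ +-monoˡ-< w D<e ⟩
              e + w ≡⟨ w≡ ⟨
              vm    ≡⟨ D+b≡ ⟨
              D + b ∎)
            w-sum : v (suc T) + vm ≡ v (suc (suc T)) + w
            w-sum = begin-equality
              v (suc T) + vm        ≡⟨ cong (v (suc T) +_) w≡ ⟩
              v (suc T) + (e + w)   ≡⟨ +-assoc (v (suc T)) e w ⟨
              v (suc T) + e + w     ≡⟨ cong (_+ w) e≡ ⟨
              v (suc (suc T)) + w   ∎
            w-coin : CoinOrZero A w
            -- The next gap, if there is one, is at least `G`, and `w < b < D < G`.
            w-coin = two-coins (suc (suc T)) T<k p<k 1+T<k w-sum λ 2+T<k → begin-strict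
              v (suc T) + vm        ≡⟨ w-sum ⟩
              v (suc (suc T)) + w   <⟨ +-monoʳ-< _ (<-trans w<b (<-trans b<D D<G)) ⟩
              v (suc (suc T)) + G   ≤⟨ after (n≤1+n (suc T)) 2+T<k ⟩
              v (suc (suc (suc T))) ∎

          no-last-short-gap : ⊥
          no-last-short-gap = no-short-gap-isolated λ 1+T<k → ≰⇒> (no-short-gap-crowded 1+T<k)

        -- Downward induction from the top coin: `n` bounds the distance from `T` to `k`, and the
        -- recursive calls supply the hypothesis on all later gaps.
        gaps-≥G : ∀ n {T} → T < k → k ≤ n + T → v T + G ≤ v (suc T)
        gaps-≥G zero T<k k≤T = contradiction k≤T (<⇒≱ T<k)
        gaps-≥G (suc n) {T} T<k k≤1+n+T = ≮⇒≥ λ v1+T< →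
          no-last-short-gap T<k after g (sym g≡) (+-cancelˡ-< (v T) g G (subst (_< v T + G) (sym g≡) v1+T<))
          where
          g = v (suc T) ∸ v T
          g≡ : v T + g ≡ v (suc T)
          g≡ = m+[n∸m]≡n (<⇒≤ (value-step A T<k))
          after : ∀ {j} → T < j → j < k → v j + G ≤ v (suc j)
          after T<j j<k = gaps-≥G n j<k
            (≤-trans k≤1+n+T (≤-trans (≤-reflexive (sym (+-suc n T))) (+-monoʳ-≤ n T<j)))

        first-short-gap-absurd : ⊥
        first-short-gap-absurd = <-asym short
          (<-≤-trans (+-monoʳ-< (v s) D<G) (gaps-≥G k s<k (m≤m+n k s)))

      -- Strong induction makes a failing `t` the first short gap. It cannot be `p` itself, whose
      -- gap is exactly `D`.
      gaps-≥D : ∀ t → p ≤ t → t < k → v t + D ≤ v (suc t)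
      gaps-≥D = <-rec _ λ t rec p≤t t<k → case m≤n⇒m<n∨m≡n p≤t of λ where
        (inj₂ refl) → ≤-reflexive (trans (+-comm b D) D+b≡)
        (inj₁ p<t) → ≮⇒≥ λ short → first-short-gap-absurd p<t t<k short
          (λ p≤j j<t → rec j<t p≤j (<-trans j<t t<k))
          (m∸n+n≡m (value-mono-≤ (suc t) (m≤n⇒m≤1+n p≤t) t<k))

theorem5p6 : (k : ℕ) (A : Currency k) → Orderly A →
    (m : ℕ) → 2 ≤ m → m ≤ k →
    2 * (a_ A (m ∸ 2)) < a_ A (m ∸ 1) →
    2 * (a_ A (m ∸ 1)) < a_ A m →
    (t : ℕ) → m ≤ t → t ≤ k ∸ 1 →
    a_ A m ∸ a_ A (m ∸ 1) ≤ a_ A (suc t) ∸ a_ A t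
theorem5p6 k A orderly (suc (suc q)) (s≤s (s≤s z≤n)) p<k@(s≤s _) 2c<b 2b<a t m≤t t≤k-1 =
  m+n≤o⇒m≤o∸n _ (subst (_≤ a_ A (suc t)) (+-comm (a_ A t) _) (gaps-≥D A orderly p<k D+b≡ (double q 2c<b) b<D t (<⇒≤ m≤t) t<k))
  where
  double : ∀ i {x} → 2 * a_ A i < x → a_ A i + a_ A i < x
  double i {x} = subst (λ y → a_ A i + y < x) (+-identityʳ (a_ A i))
  D+b≡ : a_ A (suc (suc q)) ∸ a_ A (suc q) + a_ A (suc q) ≡ a_ A (suc (suc q))
  D+b≡ = m∸n+n≡m (<⇒≤ (value-step A p<k))
  b<D : a_ A (suc q) < a_ A (suc (suc q)) ∸ a_ A (suc q)
  b<D = +-cancelʳ-< (a_ A (suc q)) _ _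
    (subst (a_ A (suc q) + a_ A (suc q) <_) (sym D+b≡) (double (suc q) 2b<a))
  t<k : t < k
  -- Matching `p<k` against `s≤s` has exposed `k` as a successor, so `k ∸ 1` computes.
  t<k = s≤s t≤k-1
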